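{- Let $$H(a_1, \ldots, a_n)=\sum_{j,k=1}^m c_{jk}\,h_j(a_1, \ldots,a_n)\,h_k(a_1, \ldots, a_n)$$ with real coefficients $c_{jk}$ and let $-\infty \le r < s \le \infty$. Put $$P(x,y)=\sum_{j,k=1}^m c_{jk}\, h_j(x,x, \ldots,x)\, h_k(y,y, \ldots, y),$$ where $x$ and $y$ are each repeated $n$ times. If $P(x,y) \ge 0$ for $(x,y) \in (r,s)^2 \setminus\{(0,0)\}$ and $H(a,a, \ldots, a)>0$ for $a \in (r,s) \setminus\{0\}$, then $H(a_1, \ldots, a_n) >0$ for all $(a_1, \ldots, a_n)\in (r,s)^n \setminus\{(0,\ldots,0)\}$.
   Context: For a nonnegative integer $j$, $h_j(a_1,\ldots,a_n)=\sum_{1\le i_1\le i_2\le\cdots\le i_j\le n}a_{i_1}a_{i_2}\cdots a_{i_j}$ is the complete homogeneous symmetric polynomial of degree $j$ in $n$ variables, with $h_0=1$. Here $n\ge1$ and $m\ge 1$ are integers, and $(r,s)\subset\mathbb{R}$ is an open interval, possibly unbounded. -}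

module Defs where

open import Level using (Level; _⊔_) renaming (suc to lsuc)
open import Algebra.Apartness.Bundles using (HeytingField; HeytingCommutativeRing)
open import Algebra.Bundles using (CommutativeRing; Semiring)
import Algebra.Definitions.RawSemiring as RawSemiringDefs
open import Data.Fin.Base as Fin using (Fin; toℕ)
import Data.Fin.Properties as Fin
open import Data.List.Base as List using (List; allFin; cartesianProductWith; filter)
open import Data.Nat.Base as ℕ using (ℕ; zero; suc)
open import Data.Product.Base using (_×_; ∃-syntax)
open import Data.Sum.Base using (_⊎_)
open import Data.Vec.Base as Vec using (Vec; []; _∷_)
open import Data.Vec.Functional using (Vector; replicate)
open import Data.Vec.Relation.Unary.Linked using (linked?)
open import Function.Bundles using (_⇔_)
open import Relation.Binary.Core using (Rel)
open import Relation.Binary.Structures using (IsStrictPartialOrder)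
import Relation.Binary.Construct.Add.Extrema.Strict as AddExtrema
open import Relation.Nullary.Construct.Add.Extrema using (_±; [_])
open import Relation.Nullary.Negation using (¬_)

-- The library has no real numbers, so ℝ is given by its axioms: it is an
-- Archimedean ordered field in which every Cauchy sequence converges.
-- Classically these axioms determine ℝ up to unique isomorphism (with _#_
-- being inequality).  They are phrased with apartness rather than with
-- trichotomy so that the reals of constructive analysis satisfy them too.

record RealField (c ℓ₁ ℓ₂ ℓ₃ : Level) : Set (lsuc (c ⊔ ℓ₁ ⊔ ℓ₂ ⊔ ℓ₃)) where
  infix 4 _<_ _≥_
  field
    heytingField : HeytingField c ℓ₁ ℓ₂

  open HeytingField heytingField public

  commutativeRing : CommutativeRing c ℓ₁
  commutativeRing = HeytingCommutativeRing.commutativeRing heytingCommutativeRing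

  open RawSemiringDefs (Semiring.rawSemiring (CommutativeRing.semiring commutativeRing)) public
    using (sum) renaming (_×_ to _·_)

  field
    _<_                  : Rel Carrier ℓ₃
    isStrictPartialOrder : IsStrictPartialOrder _≈_ _<_
    #⇔<⊎>                : ∀ {x y} → (x # y) ⇔ (x < y ⊎ y < x)
    +-monoˡ-<            : ∀ {x y} z → x < y → (x + z) < (y + z)
    *-pos                : ∀ {x y} → 0# < x → 0# < y → 0# < (x * y)
    archimedean          : ∀ x → ∃[ n ] x < n · 1#

  -- The two inequalities together say |x - y| < ε.
  Within : Carrier → Carrier → Carrier → Set ℓ₃
  Within ε x y = (x < y + ε) × (y < x + ε)

  IsCauchy : (ℕ → Carrier) → Set (c ⊔ ℓ₃)
  IsCauchy u = ∀ {ε} → 0# < ε →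
    ∃[ N ] (∀ {i j} → N ℕ.≤ i → N ℕ.≤ j → Within ε (u i) (u j))

  _ConvergesTo_ : (ℕ → Carrier) → Carrier → Set (c ⊔ ℓ₃)
  u ConvergesTo l = ∀ {ε} → 0# < ε →
    ∃[ N ] (∀ {i} → N ℕ.≤ i → Within ε (u i) l)

  field
    complete : ∀ u → IsCauchy u → ∃[ l ] u ConvergesTo l

  _≥_ : Rel Carrier ℓ₃
  x ≥ y = ¬ (x < y)

  -- Extended reals.
  open AddExtrema _<_ public using (_<±_)

  _∈⦅_,_⦆ : Carrier → Carrier ± → Carrier ± → Set (c ⊔ ℓ₃)
  x ∈⦅ r , s ⦆ = (r <± [ x ]) × ([ x ] <± s)

tuples : ∀ n j → List (Vec (Fin n) j)
tuples n zero    = List.[ [] ]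
tuples n (suc j) = cartesianProductWith _∷_ (allFin n) (tuples n j)

nondecreasing : ∀ n j → List (Vec (Fin n) j)
nondecreasing n j = filter (linked? Fin._≤?_) (tuples n j)

module _ {c ℓ₁ ℓ₂ ℓ₃} (ℝ : RealField c ℓ₁ ℓ₂ ℓ₃) where
  open RealField ℝ

  monomial : ∀ {n j} → Vector Carrier n → Vec (Fin n) j → Carrier
  monomial a is = Vec.foldr′ _*_ 1# (Vec.map a is)

  h : ∀ {n} → ℕ → Vector Carrier n → Carrier
  h {n} j a = List.foldr _+_ 0# (List.map (monomial a) (nondecreasing n j))

  -- The indices 1, …, m are represented by suc (toℕ j) for j : Fin m.
  H : ∀ {m n} → (Fin m → Fin m → Carrier) → Vector Carrier n → Carrier
  H c a = sum λ j → sum λ k →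
    (c j k * h (suc (toℕ j)) a) * h (suc (toℕ k)) a

  P : ∀ {m} n → (Fin m → Fin m → Carrier) → Carrier → Carrier → Carrier
  P n c x y = sum λ j → sum λ k →
    (c j k * h (suc (toℕ j)) (replicate n x)) * h (suc (toℕ k)) (replicate n y)

-- Write H(a) = Q(a, a) with Q(a, b) = Σ c_jk h_j(a) h_k(b), so that P(x, y) is Q at
-- the constant tuples x and y.  It suffices to treat a linear combination L of the h_j
-- in one tuple, and to apply the result to Q in each argument in turn: if L ≥ 0 at
-- constant tuples, then L ≥ 0 everywhere, and L(a) > 0 as soon as L is positive at the
-- constant tuple of some entry of a.
--
-- If (α + β) t = α x + β y, then (α + β) L(x, y, …) = α L(t, y, …) + β L(x, t, …).
-- By repeated use of this identity L(a) is bounded below by values of L at tuples that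
-- lie in short intervals; there L is almost L at a constant tuple, by a Lipschitz
-- estimate.  Hence L ≥ 0.  For strict positivity, take t = (1 - μ) x + μ y with x a fixed
-- entry: dropping the nonnegative first term moves all entries close to x at the cost
-- of a factor μ each.

module Submission where

open import Defs
open import Algebra.Apartness.Bundles using (HeytingField)
import Algebra.Apartness.Properties.HeytingCommutativeRing as HeytingProperties
open import Algebra.Bundles using (CommutativeRing)
open import Algebra.Definitions using (Invertible)
import Algebra.Properties.AbelianGroup as AbelianGroupProperties
import Algebra.Properties.Ring as RingProperties
import Algebra.Properties.Semiring.Mult.TCOptimised as Multiples
import Algebra.Properties.Semiring.Sum as SemiringSum
import Algebra.Solver.Ring
open import Algebra.Solver.Ring.AlmostCommutativeRing using (fromCommutativeRing; _-Raw-AlmostCommutative⟶_)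
open import Data.Bool.Base using (true; false; if_then_else_)
open import Data.Empty using (⊥; ⊥-elim)
open import Data.Fin.Base using (Fin; zero; suc; toℕ)
import Data.Fin.Properties as Fin
open import Data.Integer.Base as ℤ using (ℤ)
import Data.Integer.Properties as ℤ
open import Data.List.Base as List using (List; []; _∷_; _++_; length; map; allFin; cartesianProductWith; filter; foldr)
open import Data.List.Membership.Propositional.Properties using (∈-tabulate⁺; ∈-∃++)
import Data.List.Properties as List
open import Data.List.Relation.Binary.Permutation.Propositional as Perm
  using (_↭_; prep; swap; ↭-reflexive; ↭-sym; ↭-trans)
open import Data.List.Relation.Binary.Permutation.Propositional.Properties
  using (All-resp-↭; shift; ++⁺ˡ; ↭-length)
open import Data.List.Relation.Binary.Pointwise.Base using (Pointwise; []; _∷_)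
open import Data.List.Relation.Unary.All as All using (All; []; _∷_)
import Data.List.Relation.Unary.All.Properties as All
import Data.Maybe.Base as Maybe
open import Data.Nat.Base as ℕ using (ℕ; zero; suc)
open import Data.Product.Base using (_×_; _,_; ∃-syntax; proj₁; proj₂)
open import Data.Sum.Base using (_⊎_; inj₁; inj₂)
open import Data.Vec.Base using (Vec; []; _∷_)
open import Data.Vec.Functional using (Vector; replicate)
open import Data.Vec.Relation.Unary.Linked using (linked?)
open import Function.Base using (_∘_)
open import Function.Bundles using (Equivalence)
open import Level using (_⊔_)
open import Relation.Binary.Consequences using (dec⇒weaklyDec)
import Relation.Binary.Construct.Add.Extrema.Strict as Extrema
import Relation.Binary.Construct.Add.Supremum.Strict as Supremum
open import Relation.Binary.PropositionalEquality.Core as ≡ using (_≡_)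
import Relation.Binary.Reasoning.Setoid as SetoidReasoning
open import Relation.Binary.Structures using (IsStrictPartialOrder)
open import Relation.Nullary.Construct.Add.Extrema using (_±; [_]; ⊥±; ⊤±)
open import Relation.Nullary.Decidable.Core using (does; yes; no; ¬¬-excluded-middle)
open import Relation.Nullary.Negation using (¬_)
open import Relation.Unary using (Pred; Decidable)

-- A ring solver with integer coefficients.

module IntegerCoefficients {c ℓ} (R : CommutativeRing c ℓ) where
  open CommutativeRing R
  open import Data.Integer.Base using (+_; -[1+_]; _⊖_)
  open Multiples semiring using (×1-homo-*; ×-homo-+; 1+×) renaming (_×_ to _·_)
  open RingProperties ring using (-‿distribˡ-*; -‿distribʳ-*; -0#≈0#; -‿involutive)
  open AbelianGroupProperties +-abelianGroup using (⁻¹-∙-comm; xyx⁻¹≈y)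
  open SetoidReasoning setoid

  private
    ⟦_⟧ : ℤ → Carrier
    ⟦ + n      ⟧ = n · 1#
    ⟦ -[1+ n ] ⟧ = - (suc n · 1#)

    neg-homo : ∀ i → ⟦ ℤ.- i ⟧ ≈ - ⟦ i ⟧
    neg-homo (+ zero)  = sym -0#≈0#
    neg-homo (+ suc n) = refl
    neg-homo -[1+ n ]  = sym (-‿involutive _)

    ⊖-homo : ∀ m n → ⟦ m ⊖ n ⟧ ≈ m · 1# - n · 1#
    ⊖-homo m       zero    = sym (trans (+-congˡ -0#≈0#) (+-identityʳ _))
    ⊖-homo zero    (suc n) = sym (+-identityˡ _)
    ⊖-homo (suc m) (suc n) = begin
      ⟦ suc m ⊖ suc n ⟧                       ≡⟨ ≡.cong ⟦_⟧ (ℤ.[1+m]⊖[1+n]≡m⊖n m n) ⟩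
      ⟦ m ⊖ n ⟧                               ≈⟨ ⊖-homo m n ⟩
      m · 1# - n · 1#                         ≈⟨ +-congʳ (xyx⁻¹≈y 1# _) ⟨
      1# + m · 1# - 1# - n · 1#               ≈⟨ +-assoc _ _ _ ⟩
      1# + m · 1# + (- 1# - n · 1#)           ≈⟨ +-congˡ (⁻¹-∙-comm _ _) ⟩
      1# + m · 1# - (1# + n · 1#)             ≈⟨ +-cong (1+× m 1#) (-‿cong (1+× n 1#)) ⟨
      suc m · 1# - suc n · 1#                 ∎

    +-homo : ∀ i j → ⟦ i ℤ.+ j ⟧ ≈ ⟦ i ⟧ + ⟦ j ⟧
    +-homo (+ m)    (+ n)    = ×-homo-+ 1# m n
    +-homo (+ m)    -[1+ n ] = ⊖-homo m (suc n)
    +-homo -[1+ m ] (+ n)    = trans (⊖-homo n (suc m)) (+-comm _ _)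
    +-homo -[1+ m ] -[1+ n ] = begin
      - (suc (suc (m ℕ.+ n)) · 1#)         ≈⟨ -‿cong (1+× (suc (m ℕ.+ n)) 1#) ⟩
      - (1# + (suc m ℕ.+ n) · 1#)          ≈⟨ -‿cong (+-congˡ (×-homo-+ 1# (suc m) n)) ⟩
      - (1# + (suc m · 1# + n · 1#))       ≈⟨ -‿cong (trans (sym (+-assoc _ _ _)) (trans (+-congʳ (+-comm _ _)) (+-assoc _ _ _))) ⟩
      - (suc m · 1# + (1# + n · 1#))       ≈⟨ -‿cong (+-congˡ (1+× n 1#)) ⟨
      - (suc m · 1# + suc n · 1#)          ≈⟨ ⁻¹-∙-comm _ _ ⟨
      - (suc m · 1#) - suc n · 1#          ∎

    *-homo-+ : ∀ m n → ⟦ + m ℤ.* + n ⟧ ≈ ⟦ + m ⟧ * ⟦ + n ⟧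
    *-homo-+ m n = trans (reflexive (≡.cong ⟦_⟧ (≡.sym (ℤ.pos-* m n)))) (×1-homo-* m n)

    *-homo : ∀ i j → ⟦ i ℤ.* j ⟧ ≈ ⟦ i ⟧ * ⟦ j ⟧
    *-homo (+ m)    (+ n)    = *-homo-+ m n
    *-homo (+ m)    -[1+ n ] = begin
      ⟦ + m ℤ.* ℤ.- + suc n ⟧     ≡⟨ ≡.cong ⟦_⟧ (ℤ.neg-distribʳ-* (+ m) (+ suc n)) ⟨
      ⟦ ℤ.- (+ m ℤ.* + suc n) ⟧   ≈⟨ neg-homo (+ m ℤ.* + suc n) ⟩
      - ⟦ + m ℤ.* + suc n ⟧       ≈⟨ -‿cong (*-homo-+ m (suc n)) ⟩
      - (m · 1# * suc n · 1#)     ≈⟨ -‿distribʳ-* _ _ ⟩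
      m · 1# * - (suc n · 1#)     ∎
    *-homo -[1+ m ] (+ n)    = begin
      ⟦ ℤ.- + suc m ℤ.* + n ⟧     ≡⟨ ≡.cong ⟦_⟧ (ℤ.neg-distribˡ-* (+ suc m) (+ n)) ⟨
      ⟦ ℤ.- (+ suc m ℤ.* + n) ⟧   ≈⟨ neg-homo (+ suc m ℤ.* + n) ⟩
      - ⟦ + suc m ℤ.* + n ⟧       ≈⟨ -‿cong (*-homo-+ (suc m) n) ⟩
      - (suc m · 1# * n · 1#)     ≈⟨ -‿distribˡ-* _ _ ⟩
      - (suc m · 1#) * n · 1#     ∎
    *-homo -[1+ m ] -[1+ n ] = begin
      ⟦ -[1+ m ] ℤ.* -[1+ n ] ⟧           ≈⟨ *-homo-+ (suc m) (suc n) ⟩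
      suc m · 1# * suc n · 1#             ≈⟨ -‿involutive _ ⟨
      - - (suc m · 1# * suc n · 1#)       ≈⟨ -‿cong (-‿distribʳ-* _ _) ⟩
      - (suc m · 1# * - (suc n · 1#))     ≈⟨ -‿distribˡ-* _ _ ⟩
      - (suc m · 1#) * - (suc n · 1#)     ∎

    homomorphism : ℤ.+-*-rawRing -Raw-AlmostCommutative⟶ fromCommutativeRing R
    homomorphism = record
      { ⟦_⟧ = ⟦_⟧ ; +-homo = +-homo ; *-homo = *-homo ; -‿homo = neg-homo
      ; 0-homo = refl ; 1-homo = refl }

  -- Coefficients are integers because their equality is decidable, while that of `R` need not be;
  -- the normaliser can then recognise terms that cancel.
  open Algebra.Solver.Ring ℤ.+-*-rawRing (fromCommutativeRing R) homomorphism
    (λ i j → Maybe.map (reflexive ∘ ≡.cong ⟦_⟧) (dec⇒weaklyDec ℤ._≟_ i j)) public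
    using (Polynomial; solve; _:=_; _:+_; _:*_; _:-_; :-_; con)

  :0 :1 : ∀ {n} → Polynomial n
  :0 = con (+ 0)
  :1 = con (+ 1)

-- Order and arithmetic in the field, without trichotomy.

module OrderedField {ℓ₀ ℓ₁ ℓ₂ ℓ₃} (ℝ : RealField ℓ₀ ℓ₁ ℓ₂ ℓ₃) where
  open RealField ℝ public
    hiding (isEquivalence; setoid; sum; zero)
  open CommutativeRing commutativeRing public using (setoid)
  open HeytingProperties (HeytingField.heytingCommutativeRing heytingField) public using (#-congʳ; 1#0)
  open IsStrictPartialOrder isStrictPartialOrder public
    using (<-respˡ-≈; <-respʳ-≈) renaming (irrefl to <-irrefl; asym to <-asym; trans to <-trans)
  open IntegerCoefficients commutativeRing public
  open SetoidReasoning setoid public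

  infix 4 _≤_
  -- A negation is stable under double negation, so a proof of `x ≤ y` may appeal to excluded
  -- middle. The hypothesis `x ≥ y` unfolds to `y ≤ x`.
  _≤_ : Carrier → Carrier → Set ℓ₃
  x ≤ y = ¬ y < x

  ≤-resp-≈ : ∀ {x y x′ y′} → x ≈ x′ → y ≈ y′ → x ≤ y → x′ ≤ y′
  ≤-resp-≈ x≈ y≈ x≤y y<x = x≤y (<-respˡ-≈ (sym y≈) (<-respʳ-≈ (sym x≈) y<x))

  ≤-refl : ∀ {x} → x ≤ x
  ≤-refl = <-irrefl refl

  ≤-reflexive : ∀ {x y} → x ≈ y → x ≤ y
  ≤-reflexive x≈y = <-irrefl (sym x≈y)

  <⇒≤ : ∀ {x y} → x < y → x ≤ y
  <⇒≤ = <-asym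

  <⇒# : ∀ {x y} → x < y → x # y
  <⇒# = Equivalence.from #⇔<⊎> ∘ inj₁

  #⇒<⊎> : ∀ {x y} → x # y → x < y ⊎ y < x
  #⇒<⊎> = Equivalence.to #⇔<⊎>

  -- Takes the place of trichotomy: `z` is apart from `x` or from `y`, and when the order is not the
  -- desired one, transitivity gives the other alternative.
  <-cotrans : ∀ {x y} z → x < y → x < z ⊎ z < y
  <-cotrans z x<y with #-cotrans (<⇒# x<y) z
  ... | inj₁ x#z with #⇒<⊎> x#z
  ...   | inj₁ x<z = inj₁ x<z
  ...   | inj₂ z<x = inj₂ (<-trans z<x x<y)
  <-cotrans z x<y | inj₂ z#y with #⇒<⊎> z#y
  ...   | inj₁ z<y = inj₂ z<y
  ...   | inj₂ y<z = inj₁ (<-trans x<y y<z)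

  <-≤-trans : ∀ {x y z} → x < y → y ≤ z → x < z
  <-≤-trans {z = z} x<y y≤z with <-cotrans z x<y
  ... | inj₁ x<z = x<z
  ... | inj₂ z<y = ⊥-elim (y≤z z<y)

  ≤-<-trans : ∀ {x y z} → x ≤ y → y < z → x < z
  ≤-<-trans {x} x≤y y<z with <-cotrans x y<z
  ... | inj₁ y<x = ⊥-elim (x≤y y<x)
  ... | inj₂ x<z = x<z

  ≤-trans : ∀ {x y z} → x ≤ y → y ≤ z → x ≤ z
  ≤-trans x≤y y≤z z<x = y≤z (<-≤-trans z<x x≤y)

  0<-resp : ∀ {x y} → x ≈ y → 0# < x → 0# < y
  0<-resp = <-respʳ-≈

  0≤-resp : ∀ {x y} → x ≈ y → 0# ≤ x → 0# ≤ y
  0≤-resp = ≤-resp-≈ refl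

  x<y⇒0<y-x : ∀ {x y} → x < y → 0# < y - x
  x<y⇒0<y-x {x} x<y = <-respˡ-≈ (-‿inverseʳ x) (+-monoˡ-< (- x) x<y)

  0<y-x⇒x<y : ∀ {x y} → 0# < y - x → x < y
  0<y-x⇒x<y {x} {y} p = <-respˡ-≈ (+-identityˡ x)
    (<-respʳ-≈ (solve 2 (λ x y → y :- x :+ x := y) refl x y) (+-monoˡ-< x p))

  x≤y⇒0≤y-x : ∀ {x y} → x ≤ y → 0# ≤ y - x
  x≤y⇒0≤y-x {x} {y} x≤y y-x<0 = x≤y (<-respˡ-≈ (solve 2 (λ x y → y :- x :+ x := y) refl x y)
    (<-respʳ-≈ (+-identityˡ x) (+-monoˡ-< x y-x<0)))

  0≤y-x⇒x≤y : ∀ {x y} → 0# ≤ y - x → x ≤ y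
  0≤y-x⇒x≤y {x} {y} p y<x = p (<-respʳ-≈ (-‿inverseʳ x) (+-monoˡ-< (- x) y<x))

  x≤x+y : ∀ {x y} → 0# ≤ y → x ≤ x + y
  x≤x+y {x} {y} 0≤y = 0≤y-x⇒x≤y (0≤-resp (solve 2 (λ x y → y := (x :+ y) :- x) refl x y) 0≤y)

  x<0⇒0<-x : ∀ {x} → x < 0# → 0# < - x
  x<0⇒0<-x {x} = 0<-resp (+-identityˡ (- x)) ∘ x<y⇒0<y-x

  0<-x⇒x<0 : ∀ {x} → 0# < - x → x < 0#
  0<-x⇒x<0 {x} = 0<y-x⇒x<y ∘ 0<-resp (sym (+-identityˡ (- x)))

  +-≤-< : ∀ {x y} → 0# ≤ x → 0# < y → 0# < x + y
  +-≤-< {x} {y} 0≤x 0<y = ≤-<-trans 0≤x (<-respˡ-≈ (+-identityˡ x) (<-respʳ-≈ (+-comm y x) (+-monoˡ-< x 0<y)))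

  +-<-≤ : ∀ {x y} → 0# < x → 0# ≤ y → 0# < x + y
  +-<-≤ {x} {y} 0<x 0≤y = 0<-resp (+-comm y x) (+-≤-< 0≤y 0<x)

  +-nonneg : ∀ {x y} → 0# ≤ x → 0# ≤ y → 0# ≤ x + y
  +-nonneg {x} {y} 0≤x 0≤y x+y<0 =
    0≤y (0<-x⇒x<0 (0<-resp (solve 2 (λ x y → x :+ :- (x :+ y) := :- y) refl x y) (+-≤-< 0≤x (x<0⇒0<-x x+y<0))))

  -- If `z` inverts `x * y`, then `y * z` inverts `x`, and invertible elements are apart from zero.
  *-#0ˡ : ∀ {x y} → x * y # 0# → x # 0#
  *-#0ˡ {x} {y} xy#0 with #⇒invertible xy#0
  ... | z , _ , xyz≈1 = invertible⇒# (y * z , trans (*-comm _ _) eq , eq)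
    where
    eq : (x - 0#) * (y * z) ≈ 1#
    eq = trans (solve 3 (λ x y z → (x :- :0) :* (y :* z) := (x :* y :- :0) :* z) refl x y z) xyz≈1

  *-#0ʳ : ∀ {x y} → x * y # 0# → y # 0#
  *-#0ʳ {x} {y} xy#0 = *-#0ˡ (#-congʳ (*-comm x y) xy#0)

  -- A negative product would make both factors apart from zero, so their signs could be decided;
  -- only two positive factors remain, and their product is positive.
  *-nonneg : ∀ {x y} → 0# ≤ x → 0# ≤ y → 0# ≤ x * y
  *-nonneg {x} {y} 0≤x 0≤y xy<0 =
    contra (#⇒<⊎> (*-#0ˡ (<⇒# xy<0))) (#⇒<⊎> (*-#0ʳ (<⇒# xy<0)))
    where
    contra : x < 0# ⊎ 0# < x → y < 0# ⊎ 0# < y → ⊥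
    contra (inj₁ x<0) _          = 0≤x x<0
    contra (inj₂ _)   (inj₁ y<0) = 0≤y y<0
    contra (inj₂ 0<x) (inj₂ 0<y) = <-asym xy<0 (*-pos 0<x 0<y)

  *-cancel-nonneg : ∀ {x y} → 0# < x → 0# ≤ x * y → 0# ≤ y
  *-cancel-nonneg {x} {y} 0<x 0≤xy y<0 =
    0≤xy (0<-x⇒x<0 (0<-resp (solve 2 (λ x y → x :* :- y := :- (x :* y)) refl x y) (*-pos 0<x (x<0⇒0<-x y<0))))

  *-cancel-pos : ∀ {x y} → 0# < x → 0# < x * y → 0# < y
  *-cancel-pos {x} {y} 0<x 0<xy = positive (#⇒<⊎> (*-#0ʳ (#-sym (<⇒# 0<xy))))
    where
    positive : y < 0# ⊎ 0# < y → 0# < y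
    positive (inj₁ y<0) = ⊥-elim (*-cancel-nonneg 0<x (<⇒≤ 0<xy) y<0)
    positive (inj₂ 0<y) = 0<y

  0<1 : 0# < 1#
  0<1 with #⇒<⊎> 1#0
  ... | inj₂ 0<1 = 0<1
  ... | inj₁ 1<0 = 0<-resp (solve 0 (:- :1 :* :- :1 := :1) refl)
                     (*-pos (x<0⇒0<-x 1<0) (x<0⇒0<-x 1<0))

  0<⇒inverse : ∀ {x} → 0# < x → ∃[ y ] 0# < y × x * y ≈ 1#
  0<⇒inverse {x} 0<x = inverse (#⇒invertible (#-sym (<⇒# 0<x)))
    where
    inverse : Invertible _≈_ 1# _*_ (x - 0#) → ∃[ y ] 0# < y × x * y ≈ 1#
    inverse (y , _ , [x-0]y≈1) = y , *-cancel-pos 0<x (0<-resp (sym xy≈1) 0<1) , xy≈1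
      where
      xy≈1 : x * y ≈ 1#
      xy≈1 = trans (solve 2 (λ x y → x :* y := (x :- :0) :* y) refl x y) [x-0]y≈1

module HomogeneousPositivity {ℓ₀ ℓ₁ ℓ₂ ℓ₃} (ℝ : RealField ℓ₀ ℓ₁ ℓ₂ ℓ₃) where
  open OrderedField ℝ
  open SemiringSum (CommutativeRing.semiring commutativeRing) using (sum; sum-cong-≋; sum-replicate-zero)

  -- Bounds on absolute values, Archimedean estimates and approximation.

  infix 4 ∣_∣≤_
  ∣_∣≤_ : Carrier → Carrier → Set ℓ₃
  ∣ x ∣≤ B = 0# ≤ B - x × 0# ≤ B + x

  ∣∣≤-resp-≈ : ∀ {x y B C} → x ≈ y → B ≈ C → ∣ x ∣≤ B → ∣ y ∣≤ C
  ∣∣≤-resp-≈ x≈y B≈C (l , u) = 0≤-resp (+-cong B≈C (-‿cong x≈y)) l , 0≤-resp (+-cong B≈C x≈y) u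

  0<2 : 0# < 1# + 1#
  0<2 = +-<-≤ 0<1 (<⇒≤ 0<1)

  ∣∣≤⇒0≤ : ∀ {x B} → ∣ x ∣≤ B → 0# ≤ B
  ∣∣≤⇒0≤ {x} {B} (l , u) = *-cancel-nonneg 0<2
    (0≤-resp (solve 2 (λ x B → (B :- x) :+ (B :+ x) := (:1 :+ :1) :* B) refl x B) (+-nonneg l u))

  ∣∣≤-+ : ∀ {x y B C} → ∣ x ∣≤ B → ∣ y ∣≤ C → ∣ x + y ∣≤ B + C
  ∣∣≤-+ {x} {y} {B} {C} (l , u) (l′ , u′) =
    0≤-resp (solve 4 (λ x y B C → (B :- x) :+ (C :- y) := (B :+ C) :- (x :+ y)) refl x y B C) (+-nonneg l l′) ,
    0≤-resp (solve 4 (λ x y B C → (B :+ x) :+ (C :+ y) := (B :+ C) :+ (x :+ y)) refl x y B C) (+-nonneg u u′)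

  -- Twice `B * C - x * y` and twice `B * C + x * y` are sums of products of the nonnegative numbers
  -- `B - x`, `B + x`, `C - y`, `C + y`, which avoids cases on signs.
  ∣∣≤-* : ∀ {x y B C} → ∣ x ∣≤ B → ∣ y ∣≤ C → ∣ x * y ∣≤ B * C
  ∣∣≤-* {x} {y} {B} {C} (l , u) (l′ , u′) =
    *-cancel-nonneg 0<2 (0≤-resp
      (solve 4 (λ x y B C → (B :- x) :* (C :+ y) :+ (B :+ x) :* (C :- y)
        := (:1 :+ :1) :* (B :* C :- x :* y)) refl x y B C)
      (+-nonneg (*-nonneg l u′) (*-nonneg u l′))) ,
    *-cancel-nonneg 0<2 (0≤-resp
      (solve 4 (λ x y B C → (B :- x) :* (C :- y) :+ (B :+ x) :* (C :+ y)
        := (:1 :+ :1) :* (B :* C :+ x :* y)) refl x y B C)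
      (+-nonneg (*-nonneg l l′) (*-nonneg u u′)))

  ∣∣≤-weaken : ∀ {x B} C → 0# ≤ C → ∣ x ∣≤ B → ∣ x ∣≤ B + C
  ∣∣≤-weaken {x} {B} C 0≤C (l , u) =
    0≤-resp (solve 3 (λ x B C → (B :- x) :+ C := (B :+ C) :- x) refl x B C) (+-nonneg l 0≤C) ,
    0≤-resp (solve 3 (λ x B C → (B :+ x) :+ C := (B :+ C) :+ x) refl x B C) (+-nonneg u 0≤C)

  ∣x∣≤x : ∀ {x} → 0# ≤ x → ∣ x ∣≤ x
  ∣x∣≤x {x} 0≤x = ≤-reflexive (sym (-‿inverseʳ x)) , +-nonneg 0≤x 0≤x

  ∣∣≤-neg : ∀ {x B} → ∣ x ∣≤ B → ∣ - x ∣≤ B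
  ∣∣≤-neg {x} {B} (l , u) = 0≤-resp (solve 2 (λ x B → B :+ x := B :- :- x) refl x B) u , l

  ·1-nonneg : ∀ n → 0# ≤ n · 1#
  ·1-nonneg zero    = ≤-refl
  ·1-nonneg (suc n) = +-nonneg (<⇒≤ 0<1) (·1-nonneg n)

  ∣∣-bound : ∀ x → ∃[ B ] ∣ x ∣≤ B
  ∣∣-bound x with archimedean x | archimedean (- x)
  ... | m , x<m | n , -x<n = m · 1# + n · 1# ,
    0≤-resp (solve 3 (λ x m n → (m :- x) :+ n := (m :+ n) :- x) refl x (m · 1#) (n · 1#))
      (+-nonneg (<⇒≤ (x<y⇒0<y-x x<m)) (·1-nonneg n)) ,
    0≤-resp (solve 3 (λ x m n → (n :- :- x) :+ m := (m :+ n) :+ x) refl x (m · 1#) (n · 1#))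
      (+-nonneg (<⇒≤ (x<y⇒0<y-x -x<n)) (·1-nonneg m))

  ·-≈-*1 : ∀ n x → n · x ≈ (n · 1#) * x
  ·-≈-*1 zero    x = sym (zeroˡ x)
  ·-≈-*1 (suc n) x = trans (+-congˡ (·-≈-*1 n x))
    (solve 2 (λ x y → x :+ y :* x := (:1 :+ y) :* x) refl x (n · 1#))

  -- The Archimedean axiom is applied to `b * v`, where `v` is the inverse of `δ`.
  multiple-exceeds : ∀ {δ} → 0# < δ → ∀ b → ∃[ n ] b < n · δ
  multiple-exceeds {δ} 0<δ b = fromInverse (0<⇒inverse 0<δ)
    where
    fromInverse : ∃[ v ] 0# < v × δ * v ≈ 1# → ∃[ n ] b < n · δ
    fromInverse (v , _ , δv≈1) = n , 0<y-x⇒x<y (0<-resp eq (*-pos (x<y⇒0<y-x (proj₂ (archimedean (b * v)))) 0<δ))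
      where
      n = proj₁ (archimedean (b * v))
      eq : (n · 1# - b * v) * δ ≈ n · δ - b
      eq = begin
        (n · 1# - b * v) * δ       ≈⟨ solve 4 (λ n b v δ → (n :- b :* v) :* δ := n :* δ :- b :* (δ :* v)) refl (n · 1#) b v δ ⟩
        (n · 1#) * δ - b * (δ * v) ≈⟨ +-cong (sym (·-≈-*1 n δ)) (-‿cong (trans (*-congˡ δv≈1) (*-identityʳ b))) ⟩
        n · δ - b                  ∎

  -- The witness is `μ = ε / (ε + 1 + M)`, for which `1 - μ = (1 + M) / (ε + 1 + M)` and
  -- `ε - M * μ = ε * (1 + ε) / (ε + 1 + M)`.
  scale-below : ∀ {ε M} → 0# < ε → 0# ≤ M → ∃[ μ ] 0# < μ × 0# < 1# - μ × 0# < ε - M * μ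
  scale-below {ε} {M} 0<ε 0≤M = fromInverse (0<⇒inverse (+-<-≤ 0<ε (<⇒≤ (+-<-≤ 0<1 0≤M))))
    where
    fromInverse : ∃[ v ] 0# < v × (ε + (1# + M)) * v ≈ 1# → ∃[ μ ] 0# < μ × 0# < 1# - μ × 0# < ε - M * μ
    fromInverse (v , 0<v , sv≈1) = ε * v , *-pos 0<ε 0<v ,
      0<-resp
        (trans (solve 3 (λ ε M v → (:1 :+ M) :* v := (ε :+ (:1 :+ M)) :* v :- ε :* v) refl ε M v)
          (+-congʳ sv≈1))
        (*-pos (+-<-≤ 0<1 0≤M) 0<v) ,
      0<-resp
        (trans (solve 3 (λ ε M v → ε :* v :* (:1 :+ ε) := ε :* ((ε :+ (:1 :+ M)) :* v) :- M :* (ε :* v)) refl ε M v)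
          (+-congʳ (trans (*-congˡ sv≈1) (*-identityʳ ε))))
        (*-pos (*-pos 0<ε 0<v) (+-<-≤ 0<1 (<⇒≤ 0<ε)))

  -- One constant `K` bounds both values and is a Lipschitz constant at scale `w`: a Lipschitz
  -- estimate passes to products only together with bounds on the factors.
  record Near (K w x y : Carrier) : Set ℓ₃ where
    constructor near
    field
      boundˡ : ∣ x ∣≤ K
      boundʳ : ∣ y ∣≤ K
      close  : ∣ x - y ∣≤ K * w

  near-refl : ∀ {K w x} → 0# ≤ w → ∣ x ∣≤ K → Near K w x x
  near-refl {x = x} 0≤w ∣x∣≤K = near ∣x∣≤K ∣x∣≤K (0≤Kw-0 , 0≤Kw+0)
    where
    0≤Kw = *-nonneg (∣∣≤⇒0≤ ∣x∣≤K) 0≤w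
    0≤Kw-0 = 0≤-resp (solve 2 (λ e x → e := e :- (x :- x)) refl _ x) 0≤Kw
    0≤Kw+0 = 0≤-resp (solve 2 (λ e x → e := e :+ (x :- x)) refl _ x) 0≤Kw

  near-+ : ∀ {K L w x y x′ y′} → Near K w x y → Near L w x′ y′ → Near (K + L) w (x + x′) (y + y′)
  near-+ {K} {L} {w} {x} {y} {x′} {y′} (near p q r) (near p′ q′ r′) = near (∣∣≤-+ p p′) (∣∣≤-+ q q′)
    (∣∣≤-resp-≈ (solve 4 (λ x y x′ y′ → (x :- y) :+ (x′ :- y′) := (x :+ x′) :- (y :+ y′)) refl x y x′ y′)
      (sym (distribʳ w K L)) (∣∣≤-+ r r′))

  -- The constant doubles because `x * x′ - y * y′` is `x * (x′ - y′) + (x - y) * y′`, with each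
  -- term at most `K * L * w`; the bounds on the values are weakened to match.
  near-* : ∀ {K L w x y x′ y′} → Near K w x y → Near L w x′ y′ → Near (K * L + K * L) w (x * x′) (y * y′)
  near-* {K} {L} {w} {x} {y} {x′} {y′} (near p q r) (near p′ q′ r′) =
    near (∣∣≤-weaken (K * L) 0≤KL (∣∣≤-* p p′)) (∣∣≤-weaken (K * L) 0≤KL (∣∣≤-* q q′))
      (∣∣≤-resp-≈ (solve 4 (λ x y x′ y′ → x :* (x′ :- y′) :+ (x :- y) :* y′ := x :* x′ :- y :* y′) refl x y x′ y′)
        (solve 3 (λ K L w → K :* (L :* w) :+ K :* w :* L := (K :* L :+ K :* L) :* w) refl K L w)
        (∣∣≤-+ (∣∣≤-* p r′) (∣∣≤-* r q′)))
    where 0≤KL = *-nonneg (∣∣≤⇒0≤ p) (∣∣≤⇒0≤ p′)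

  near-replicate : ∀ {B δ x ys} → All (λ y → Near B δ y x) ys → Pointwise (Near B δ) ys (List.replicate (length ys) x)
  near-replicate []       = []
  near-replicate (q ∷ qs) = q ∷ near-replicate qs

  -- Complete homogeneous polynomials of a list

  -- The recursion separates the monomials divisible by the head from the others.
  hˡ : ℕ → List Carrier → Carrier
  hˡ zero    xs       = 1#
  hˡ (suc j) []       = 0#
  hˡ (suc j) (x ∷ xs) = x * hˡ j (x ∷ xs) + hˡ (suc j) xs

  -- The recursion of divided differences as a polynomial identity, valid also for `x ≈ y`. It
  -- precedes symmetry, which is derived from it.
  hˡ-diff : ∀ j x y zs → hˡ (suc j) (x ∷ zs) - hˡ (suc j) (y ∷ zs) ≈ (x - y) * hˡ j (x ∷ y ∷ zs)
  hˡ-diff zero    x y zs =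
    solve 3 (λ x y r → (x :* :1 :+ r) :- (y :* :1 :+ r) := (x :- y) :* :1) refl x y (hˡ 1 zs)
  hˡ-diff (suc j) x y zs = begin
    x * u + r - (y * v + r)              ≈⟨ solve 5 (λ x y u v r → (x :* u :+ r) :- (y :* v :+ r) := x :* (u :- v) :+ (x :- y) :* v) refl x y u v r ⟩
    x * (u - v) + (x - y) * v            ≈⟨ +-congʳ (*-congˡ (hˡ-diff j x y zs)) ⟩
    x * ((x - y) * E) + (x - y) * v      ≈⟨ solve 4 (λ x y v E → x :* ((x :- y) :* E) :+ (x :- y) :* v := (x :- y) :* (x :* E :+ v)) refl x y v E ⟩
    (x - y) * (x * E + v)                ∎
    where
    u = hˡ (suc j) (x ∷ zs)
    v = hˡ (suc j) (y ∷ zs)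
    r = hˡ (suc (suc j)) zs
    E = hˡ j (x ∷ y ∷ zs)

  -- Split `x * E` into `(x - y) * E + y * E`. By `hˡ-diff` the first summand is exactly what
  -- exchanges `hˡ (suc j) (y ∷ zs)` for `hˡ (suc j) (x ∷ zs)`; induction swaps the variables in
  -- `E`.
  hˡ-swap : ∀ j x y zs → hˡ j (x ∷ y ∷ zs) ≈ hˡ j (y ∷ x ∷ zs)
  hˡ-swap zero    x y zs = refl
  hˡ-swap (suc j) x y zs = begin
    x * E + (y * v + r)                        ≈⟨ solve 5 (λ x y E v r → x :* E :+ (y :* v :+ r) := (x :- y) :* E :+ (y :* E :+ (y :* v :+ r))) refl x y E v r ⟩
    (x - y) * E + (y * E + (y * v + r))        ≈⟨ +-congʳ (hˡ-diff j x y zs) ⟨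
    (x * u + r - (y * v + r)) + (y * E + (y * v + r))
                                               ≈⟨ solve 6 (λ x y E u v r → ((x :* u :+ r) :- (y :* v :+ r)) :+ (y :* E :+ (y :* v :+ r)) := y :* E :+ (x :* u :+ r)) refl x y E u v r ⟩
    y * E + (x * u + r)                        ≈⟨ +-congʳ (*-congˡ (hˡ-swap j x y zs)) ⟩
    y * hˡ j (y ∷ x ∷ zs) + (x * u + r)        ∎
    where
    u = hˡ j (x ∷ zs)
    v = hˡ j (y ∷ zs)
    r = hˡ (suc j) zs
    E = hˡ j (x ∷ y ∷ zs)

  hˡ-prep : ∀ j x {xs ys} → (∀ k → hˡ k xs ≈ hˡ k ys) → hˡ j (x ∷ xs) ≈ hˡ j (x ∷ ys)
  hˡ-prep zero    x eq = refl
  hˡ-prep (suc j) x eq = +-cong (*-congˡ (hˡ-prep j x eq)) (eq (suc j))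

  hˡ-↭ : ∀ j {xs ys} → xs ↭ ys → hˡ j xs ≈ hˡ j ys
  hˡ-↭ j Perm.refl          = refl
  hˡ-↭ j (prep x p)         = hˡ-prep j x (λ k → hˡ-↭ k p)
  hˡ-↭ j (swap {xs} x y p)  = trans (hˡ-swap j x y xs) (hˡ-prep j y (λ k → hˡ-prep k x (λ l → hˡ-↭ l p)))
  hˡ-↭ j (Perm.trans p q)   = trans (hˡ-↭ j p) (hˡ-↭ j q)

  -- `A - B` and `A - C` are multiples of the same `G`, with factors `x - t` and `y - t`; weighted
  -- by `α` and `β` these factors cancel, by the equation for `t`.
  hˡ-knot : ∀ j {α β x y t} zs → (α + β) * t ≈ α * x + β * y →
    (α + β) * hˡ j (x ∷ y ∷ zs) ≈ α * hˡ j (t ∷ y ∷ zs) + β * hˡ j (x ∷ t ∷ zs)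
  hˡ-knot zero    {α} {β} zs eq = distribʳ 1# α β
  hˡ-knot (suc j) {α} {β} {x} {y} {t} zs eq = begin
    (α + β) * A
      ≈⟨ solve 5 (λ α β A B C → (α :+ β) :* A := (α :* B :+ β :* C) :+ (α :* (A :- B) :+ β :* (A :- C))) refl α β A B C ⟩
    (α * B + β * C) + (α * (A - B) + β * (A - C))
      ≈⟨ +-congˡ (+-cong (*-congˡ A-B) (*-congˡ A-C)) ⟩
    (α * B + β * C) + (α * ((x - t) * G) + β * ((y - t) * G))
      ≈⟨ solve 8 (λ α β x y t B C G → (α :* B :+ β :* C) :+ (α :* ((x :- t) :* G) :+ β :* ((y :- t) :* G)) :=
          (α :* B :+ β :* C) :+ ((α :* x :+ β :* y) :- (α :+ β) :* t) :* G) refl α β x y t B C G ⟩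
    (α * B + β * C) + ((α * x + β * y) - (α + β) * t) * G
      ≈⟨ +-congˡ (*-congʳ (+-congʳ eq)) ⟨
    (α * B + β * C) + ((α + β) * t - (α + β) * t) * G
      ≈⟨ solve 3 (λ P s G → P :+ (s :- s) :* G := P) refl (α * B + β * C) ((α + β) * t) G ⟩
    α * B + β * C ∎
    where
    A = hˡ (suc j) (x ∷ y ∷ zs)
    B = hˡ (suc j) (t ∷ y ∷ zs)
    C = hˡ (suc j) (x ∷ t ∷ zs)
    G = hˡ j (x ∷ t ∷ y ∷ zs)
    A-B : A - B ≈ (x - t) * G
    A-B = hˡ-diff j x t (y ∷ zs)
    A-C : A - C ≈ (y - t) * G
    A-C = begin
      A - C                                                   ≈⟨ +-cong (hˡ-swap (suc j) x y zs) (-‿cong (hˡ-swap (suc j) x t zs)) ⟩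
      hˡ (suc j) (y ∷ x ∷ zs) - hˡ (suc j) (t ∷ x ∷ zs)       ≈⟨ hˡ-diff j y t (x ∷ zs) ⟩
      (y - t) * hˡ j (y ∷ t ∷ x ∷ zs)
        ≈⟨ *-congˡ (hˡ-↭ j (↭-trans (swap y t Perm.refl) (↭-trans (prep t (swap y x Perm.refl)) (swap t x Perm.refl)))) ⟩
      (y - t) * G                                             ∎

  -- Follows the recursion of `hˡ`, with the constants that `near-*` and `near-+` produce.
  hˡ-bound : Carrier → ℕ → ℕ → Carrier
  hˡ-bound B zero    n       = 1#
  hˡ-bound B (suc j) zero    = 0#
  hˡ-bound B (suc j) (suc n) = (B * hˡ-bound B j (suc n) + B * hˡ-bound B j (suc n)) + hˡ-bound B (suc j) n

  hˡ-near : ∀ {B w} j → 0# ≤ w → ∀ {xs ys} → Pointwise (Near B w) xs ys →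
    Near (hˡ-bound B j (length xs)) w (hˡ j xs) (hˡ j ys)
  hˡ-near zero    0≤w _        = near-refl 0≤w (∣x∣≤x (<⇒≤ 0<1))
  hˡ-near (suc j) 0≤w []       = near-refl 0≤w (∣x∣≤x ≤-refl)
  hˡ-near (suc j) 0≤w (p ∷ ps) = near-+ (near-* p (hˡ-near j 0≤w (p ∷ ps))) (hˡ-near (suc j) 0≤w ps)

  -- Divided differences of f at a₁, …, aₙ are integrals against the B-spline with
  -- knots aᵢ; the field `knot` is knot insertion, which all hˡ j satisfy since hˡ j is
  -- the divided difference of x ↦ x ^ (j + n - 1).
  record KnotFunctional (L : List Carrier → Carrier) : Set (ℓ₀ ⊔ ℓ₁ ⊔ ℓ₃) where
    field
      ↭-invariant : ∀ {xs ys} → xs ↭ ys → L xs ≈ L ys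
      knot        : ∀ {α β x y t} zs → (α + β) * t ≈ α * x + β * y →
                    (α + β) * L (x ∷ y ∷ zs) ≈ α * L (t ∷ y ∷ zs) + β * L (x ∷ t ∷ zs)
      bound       : Carrier → ℕ → Carrier
      lipschitz   : ∀ {B w} → 0# ≤ w → ∀ {xs ys} → Pointwise (Near B w) xs ys →
                    Near (bound B (length xs)) w (L xs) (L ys)

  open KnotFunctional public

  -- Linear combinations of complete homogeneous polynomials as knot functionals.

  hˡ-functional : ∀ j → KnotFunctional (hˡ j)
  hˡ-functional j = record
    { ↭-invariant = hˡ-↭ j ; knot = hˡ-knot j ; bound = λ B → hˡ-bound B j ; lipschitz = hˡ-near j }

  0-functional : KnotFunctional (λ _ → 0#)
  0-functional = record
    { ↭-invariant = λ _ → refl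
    ; knot = λ {α} {β} _ _ → solve 2 (λ α β → (α :+ β) :* :0 := α :* :0 :+ β :* :0) refl α β
    ; bound = λ _ _ → 0#
    ; lipschitz = λ 0≤w _ → near-refl 0≤w (∣x∣≤x ≤-refl) }

  +-functional : ∀ {L M} → KnotFunctional L → KnotFunctional M → KnotFunctional (λ xs → L xs + M xs)
  +-functional {L} {M} F G = record
    { ↭-invariant = λ p → +-cong (↭-invariant F p) (↭-invariant G p)
    ; knot = λ {α} {β} {x} {y} {t} zs eq → begin
        (α + β) * (L (x ∷ y ∷ zs) + M (x ∷ y ∷ zs))
          ≈⟨ distribˡ (α + β) _ _ ⟩
        (α + β) * L (x ∷ y ∷ zs) + (α + β) * M (x ∷ y ∷ zs)
          ≈⟨ +-cong (knot F zs eq) (knot G zs eq) ⟩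
        (α * L (t ∷ y ∷ zs) + β * L (x ∷ t ∷ zs)) + (α * M (t ∷ y ∷ zs) + β * M (x ∷ t ∷ zs))
          ≈⟨ solve 6 (λ α β a b c d → (α :* a :+ β :* b) :+ (α :* c :+ β :* d) := α :* (a :+ c) :+ β :* (b :+ d)) refl
              α β (L (t ∷ y ∷ zs)) (L (x ∷ t ∷ zs)) (M (t ∷ y ∷ zs)) (M (x ∷ t ∷ zs)) ⟩
        α * (L (t ∷ y ∷ zs) + M (t ∷ y ∷ zs)) + β * (L (x ∷ t ∷ zs) + M (x ∷ t ∷ zs)) ∎
    ; bound = λ B n → bound F B n + bound G B n
    ; lipschitz = λ 0≤w ps → near-+ (lipschitz F 0≤w ps) (lipschitz G 0≤w ps) }

  *-functionalˡ : ∀ d {L} → KnotFunctional L → KnotFunctional (λ xs → d * L xs)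
  *-functionalˡ d {L} F = record
    { ↭-invariant = λ p → *-congˡ (↭-invariant F p)
    ; knot = λ {α} {β} {x} {y} {t} zs eq → begin
        (α + β) * (d * L (x ∷ y ∷ zs))
          ≈⟨ solve 3 (λ s d a → s :* (d :* a) := d :* (s :* a)) refl (α + β) d (L (x ∷ y ∷ zs)) ⟩
        d * ((α + β) * L (x ∷ y ∷ zs))
          ≈⟨ *-congˡ (knot F zs eq) ⟩
        d * (α * L (t ∷ y ∷ zs) + β * L (x ∷ t ∷ zs))
          ≈⟨ solve 5 (λ d α β a b → d :* (α :* a :+ β :* b) := α :* (d :* a) :+ β :* (d :* b)) refl
              d α β (L (t ∷ y ∷ zs)) (L (x ∷ t ∷ zs)) ⟩
        α * (d * L (t ∷ y ∷ zs)) + β * (d * L (x ∷ t ∷ zs)) ∎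
    ; bound = λ B n → proj₁ (∣∣-bound d) * bound F B n + proj₁ (∣∣-bound d) * bound F B n
    ; lipschitz = λ 0≤w ps → near-* (near-refl 0≤w (proj₂ (∣∣-bound d))) (lipschitz F 0≤w ps) }

  resp-functional : ∀ {L M} → (∀ xs → L xs ≈ M xs) → KnotFunctional L → KnotFunctional M
  resp-functional eq F = record
    { ↭-invariant = λ p → trans (sym (eq _)) (trans (↭-invariant F p) (eq _))
    ; knot = λ zs t → trans (*-congˡ (sym (eq _))) (trans (knot F zs t) (+-cong (*-congˡ (eq _)) (*-congˡ (eq _))))
    ; bound = bound F
    ; lipschitz = λ 0≤w {xs} {ys} ps → near-resp (eq xs) (eq ys) (lipschitz F 0≤w ps) }
    where
    near-resp : ∀ {K w x y x′ y′} → x ≈ x′ → y ≈ y′ → Near K w x y → Near K w x′ y′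
    near-resp p q (near a b d) = near (∣∣≤-resp-≈ p refl a) (∣∣≤-resp-≈ q refl b) (∣∣≤-resp-≈ (+-cong p (-‿cong q)) refl d)

  *-functionalʳ : ∀ d {L} → KnotFunctional L → KnotFunctional (λ xs → L xs * d)
  *-functionalʳ d F = resp-functional (λ _ → *-comm d _) (*-functionalˡ d F)

  sum-functional : ∀ {m} (L : Fin m → List Carrier → Carrier) → (∀ i → KnotFunctional (L i)) →
    KnotFunctional (λ xs → sum (λ i → L i xs))
  sum-functional {zero}  L F = 0-functional
  sum-functional {suc m} L F = +-functional (F zero) (sum-functional (λ i → L (suc i)) (λ i → F (suc i)))

  -- The constant bounds the absolute value of `L` at the tuple of zeros.
  bound-nonneg : ∀ {L} (F : KnotFunctional L) {B} → 0# ≤ B → ∀ n → 0# ≤ bound F B n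
  bound-nonneg F {B} 0≤B n = ≡.subst (λ k → 0# ≤ bound F B k) (List.length-replicate n)
    (∣∣≤⇒0≤ (Near.boundˡ (lipschitz F (≤-refl {0#}) (zeros n))))
    where
    zeros : ∀ k → Pointwise (Near B 0#) (List.replicate k 0#) (List.replicate k 0#)
    zeros zero    = []
    zeros (suc k) = near-refl ≤-refl
      (0≤-resp (solve 1 (λ B → B := B :- :0) refl B) 0≤B , 0≤-resp (sym (+-identityʳ B)) 0≤B) ∷ zeros k

  -- Positivity on the diagonal implies positivity

  -- The weighted mean `t` is described without division. `α` may vanish because in `split` it is
  -- `y - c` with only `c ≤ y` known.
  Convex : ∀ {p} → (Carrier → Set p) → Set (ℓ₀ ⊔ ℓ₁ ⊔ ℓ₃ ⊔ p)
  Convex I = ∀ {α β x y t} → 0# ≤ α → 0# < β → (α + β) * t ≈ α * x + β * y → I x → I y → I t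

  ∣∣≤-convex : ∀ {B} → Convex (∣_∣≤ B)
  ∣∣≤-convex {B} {α} {β} {x} {y} {t} 0≤α 0<β eq (l , u) (l′ , u′) =
    *-cancel-nonneg 0<α+β (0≤-resp
      (trans (solve 5 (λ α β x y B → α :* (B :- x) :+ β :* (B :- y) := (α :+ β) :* B :- (α :* x :+ β :* y)) refl α β x y B)
        (trans (+-congˡ (-‿cong (sym eq))) (solve 3 (λ s t B → s :* B :- s :* t := s :* (B :- t)) refl (α + β) t B)))
      (+-nonneg (*-nonneg 0≤α l) (*-nonneg (<⇒≤ 0<β) l′))) ,
    *-cancel-nonneg 0<α+β (0≤-resp
      (trans (solve 5 (λ α β x y B → α :* (B :+ x) :+ β :* (B :+ y) := (α :+ β) :* B :+ (α :* x :+ β :* y)) refl α β x y B)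
        (trans (+-congˡ (sym eq)) (solve 3 (λ s t B → s :* B :+ s :* t := s :* (B :+ t)) refl (α + β) t B)))
      (+-nonneg (*-nonneg 0≤α u) (*-nonneg (<⇒≤ 0<β) u′)))
    where 0<α+β = +-≤-< 0≤α 0<β

  All-∣∣-bound : ∀ xs → ∃[ B ] 0# < B × All (∣_∣≤ B) xs
  All-∣∣-bound []       = 1# , 0<1 , []
  All-∣∣-bound (x ∷ xs) = C + B , +-≤-< 0≤C 0<B ,
    ∣∣≤-weaken B (<⇒≤ 0<B) (proj₂ (∣∣-bound x)) ∷
    All.map (λ p → ∣∣≤-resp-≈ refl (+-comm B C) (∣∣≤-weaken C 0≤C p)) (proj₂ (proj₂ (All-∣∣-bound xs)))
    where
    C = proj₁ (∣∣-bound x)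
    0≤C = ∣∣≤⇒0≤ (proj₂ (∣∣-bound x))
    B = proj₁ (All-∣∣-bound xs)
    0<B = proj₁ (proj₂ (All-∣∣-bound xs))

  contract : (x μ y : Carrier) → Carrier
  contract x μ y = (1# - μ) * x + μ * y

  contract-knot : ∀ x μ y → ((1# - μ) + μ) * contract x μ y ≈ (1# - μ) * x + μ * y
  contract-knot x μ y = solve 3 (λ x μ y →
    ((:1 :- μ) :+ μ) :* ((:1 :- μ) :* x :+ μ :* y) := (:1 :- μ) :* x :+ μ :* y) refl x μ y

  -- `contract x μ y - x` equals `(y - x) * μ`, and `y - x` is bounded by `B + B`.
  near-contract : ∀ {B x μ y} → 0# < μ → 0# < 1# - μ → ∣ x ∣≤ B → ∣ y ∣≤ B → Near (B + B) μ (contract x μ y) x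
  near-contract {B} {x} {μ} {y} 0<μ 0<1-μ x≤ y≤ = near
    (∣∣≤-weaken B (∣∣≤⇒0≤ x≤) (∣∣≤-convex (<⇒≤ 0<1-μ) 0<μ (contract-knot x μ y) x≤ y≤))
    (∣∣≤-weaken B (∣∣≤⇒0≤ x≤) x≤)
    (∣∣≤-resp-≈ (solve 3 (λ x μ y → (y :+ :- x) :* μ := ((:1 :- μ) :* x :+ μ :* y) :- x) refl x μ y) refl
      (∣∣≤-* (∣∣≤-+ y≤ (∣∣≤-neg x≤)) (∣x∣≤x (<⇒≤ 0<μ))))

  shift₂ : ∀ (ms ls : List Carrier) {y rs} → ms ++ ls ++ y ∷ rs ↭ y ∷ ms ++ ls ++ rs
  shift₂ ms ls {y} {rs} = ↭-trans (++⁺ˡ ms (shift y ls rs)) (shift y ms (ls ++ rs))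

  module _ {L : List Carrier → Carrier} (F : KnotFunctional L) where

    -- Knot insertion makes a value of `L` a weighted mean of two others, so a common lower bound
    -- `- e` passes on without loss. Errors do not accumulate, however many knots are inserted.
    knot-≥ : ∀ {α β x y t e zs} → 0# ≤ α → 0# < β → (α + β) * t ≈ α * x + β * y →
      0# ≤ L (t ∷ y ∷ zs) + e → 0# ≤ L (x ∷ t ∷ zs) + e → 0# ≤ L (x ∷ y ∷ zs) + e
    knot-≥ {α} {β} {x} {y} {t} {e} {zs} 0≤α 0<β eq p q = *-cancel-nonneg (+-≤-< 0≤α 0<β) (0≤-resp
      (begin
        α * (B + e) + β * (C + e)       ≈⟨ solve 5 (λ α β B C e → α :* (B :+ e) :+ β :* (C :+ e) := (α :* B :+ β :* C) :+ (α :+ β) :* e) refl α β B C e ⟩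
        (α * B + β * C) + (α + β) * e   ≈⟨ +-congʳ (knot F zs eq) ⟨
        (α + β) * A + (α + β) * e       ≈⟨ distribˡ (α + β) A e ⟨
        (α + β) * (A + e)               ∎)
      (+-nonneg (*-nonneg 0≤α p) (*-nonneg (<⇒≤ 0<β) q)))
      where
      A = L (x ∷ y ∷ zs)
      B = L (t ∷ y ∷ zs)
      C = L (x ∷ t ∷ zs)

    ↭-≥ : ∀ {xs ys e} → xs ↭ ys → 0# ≤ L ys + e → 0# ≤ L xs + e
    ↭-≥ p = 0≤-resp (+-congʳ (↭-invariant F (↭-sym p)))

    module _ {p} {J : Carrier → Set p} (convex : Convex J)
      {B} (0<B : 0# < B) (J⇒∣∣≤B : ∀ {x} → J x → ∣ x ∣≤ B)
      n (diagonal : ∀ {x} → J x → 0# ≤ L (List.replicate (suc n) x)) where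

      private K = bound F B (suc n)

      Window : Carrier → Carrier → Carrier → Set (ℓ₃ ⊔ p)
      Window u w x = J x × u ≤ x × x ≤ u + w

      window⇒near : ∀ {δ u x y} → Window u (B * δ) x → Window u (B * δ) y → Near B δ y x
      window⇒near {δ} {u} {x} {y} (Jx , u≤x , x≤) (Jy , u≤y , y≤) = near (J⇒∣∣≤B Jy) (J⇒∣∣≤B Jx)
        ( 0≤-resp (solve 4 (λ u x y w → (u :+ w :- y) :+ (x :- u) := w :- (y :- x)) refl u x y (B * δ))
            (+-nonneg (x≤y⇒0≤y-x y≤) (x≤y⇒0≤y-x u≤x))
        , 0≤-resp (solve 4 (λ u x y w → (u :+ w :- x) :+ (y :- u) := w :+ (y :- x)) refl u x y (B * δ))
            (+-nonneg (x≤y⇒0≤y-x x≤) (x≤y⇒0≤y-x u≤y)))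

      -- On an interval of length `B * δ` the Lipschitz estimate compares `L` with its nonnegative
      -- value at the constant tuple of the first entry, at a loss of at most `K * δ`.
      narrow : ∀ {δ u} → 0# ≤ δ → ∀ {xs} → length xs ≡ suc n → All (Window u (B * δ)) xs → 0# ≤ L xs + K * δ
      narrow {δ} 0≤δ {x ∷ ys} len ws@(w@(Jx , _) ∷ _) = 0≤-resp
        (solve 3 (λ a b e → b :+ (e :+ (a :- b)) := a :+ e) refl (L (x ∷ ys)) (L (List.replicate (suc n) x)) (K * δ))
        (+-nonneg (diagonal Jx) (proj₂ (≡.subst
          (λ k → ∣ L (x ∷ ys) - L (List.replicate k x) ∣≤ bound F B k * δ) len
          (Near.close (lipschitz F 0≤δ (near-replicate (All.map (window⇒near w) ws)))))))

      module _ {δ} (0≤δ : 0# ≤ δ) where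

        private
          e = K * δ
          σ = B * δ
          0≤σ : 0# ≤ σ
          0≤σ = *-nonneg (<⇒≤ 0<B) 0≤δ

        module _ {u v} (left : ∀ {xs} → length xs ≡ suc n → All (Window u v) xs → 0# ≤ L xs + e) where

          private c = u + v

          -- Inserting c as a knot between x < c and y ≥ c replaces the one or the other by c,
          -- until no points are left on one side of c.
          split : ∀ ms ls rs → All (λ z → Window u v z × Window c σ z) ms →
            All (λ x → Window u v x × x < c) ls → All (Window c σ) rs →
            length (ms ++ ls ++ rs) ≡ suc n → 0# ≤ L (ms ++ ls ++ rs) + e
          split ms []       rs       Ms Ls Rs len = narrow 0≤δ len (All.++⁺ (All.map proj₂ Ms) Rs)
          split ms (x ∷ ls) []       Ms Ls Rs len = left len (All.++⁺ (All.map proj₁ Ms) (All.++⁺ (All.map proj₁ Ls) []))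
          split ms (x ∷ ls) (y ∷ rs) Ms (X@((Jx , u≤x , x≤c) , x<c) ∷ Ls) (Y@(Jy , c≤y , _) ∷ Rs) len =
            ↭-≥ xy (knot-≥ 0≤y-c 0<c-x c-knot
              (↭-≥ (↭-sym cy) (split (c ∷ ms) ls (y ∷ rs) (C ∷ Ms) Ls (Y ∷ Rs) (≡.trans (↭-length cy) (≡.trans (≡.sym (↭-length xy)) len))))
              (↭-≥ (↭-sym cx) (split (c ∷ ms) (x ∷ ls) rs (C ∷ Ms) (X ∷ Ls) Rs (≡.trans (↭-length cx) (≡.trans (≡.sym (↭-length xy)) len)))))
            where
            0≤y-c = x≤y⇒0≤y-x c≤y
            0<c-x = x<y⇒0<y-x x<c
            c-knot : ((y - c) + (c - x)) * c ≈ (y - c) * x + (c - x) * y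
            c-knot = solve 3 (λ x y c → ((y :- c) :+ (c :- x)) :* c := (y :- c) :* x :+ (c :- x) :* y) refl x y c
            Jc = convex 0≤y-c 0<c-x c-knot Jx Jy
            -- `c` is the right end of one window and the left end of the next, so it fits whichever
            -- side runs out of points first.
            C : Window u v c × Window c σ c
            C = (Jc , ≤-trans u≤x x≤c , ≤-refl) , (Jc , ≤-refl , x≤x+y 0≤σ)
            xy : ms ++ (x ∷ ls) ++ (y ∷ rs) ↭ x ∷ y ∷ ms ++ ls ++ rs
            xy = ↭-trans (shift x ms _) (prep x (shift₂ ms ls))
            cy : c ∷ ms ++ ls ++ (y ∷ rs) ↭ c ∷ y ∷ ms ++ ls ++ rs
            cy = prep c (shift₂ ms ls)
            cx : c ∷ ms ++ (x ∷ ls) ++ rs ↭ x ∷ c ∷ ms ++ ls ++ rs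
            cx = ↭-trans (prep c (shift x ms _)) (swap c x Perm.refl)

          -- The order is undecidable, but the conclusion is a negation, so that each point of ps
          -- may be compared with c.
          widen : ∀ ps ls rs → All (Window u (σ + v)) ps →
            All (λ x → Window u v x × x < c) ls → All (Window c σ) rs →
            length (ps ++ ls ++ rs) ≡ suc n → 0# ≤ L (ps ++ ls ++ rs) + e
          widen []       ls rs Ps Ls Rs len = split [] ls rs [] Ls Rs len
          widen (p ∷ ps) ls rs ((Jp , u≤p , p≤) ∷ Ps) Ls Rs len neg = ¬¬-excluded-middle λ
            { (yes p<c) → ↭-≥ (↭-sym (shift p ps (ls ++ rs)))
                (widen ps (p ∷ ls) rs Ps (((Jp , u≤p , <⇒≤ p<c) , p<c) ∷ Ls) Rs
                  (≡.trans (↭-length (shift p ps (ls ++ rs))) len)) neg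
            ; (no c≤p) → ↭-≥ (↭-sym (shift₂ ps ls))
                (widen ps ls (p ∷ rs) Ps Ls ((Jp , c≤p , ≤-resp-≈ refl p≤c+σ p≤) ∷ Rs)
                  (≡.trans (↭-length (shift₂ ps ls)) len)) neg }
            where
            p≤c+σ : u + (σ + v) ≈ u + v + σ
            p≤c+σ = solve 3 (λ u s t → u :+ (s :+ t) := u :+ t :+ s) refl u σ v

        -- Induction on the number of intervals of length `σ`: the last one is cut off at
        -- `u + k · σ`, and the error `e` stays the same.
        wide : ∀ k {u xs} → length xs ≡ suc n → All (Window u (k · σ)) xs → 0# ≤ L xs + e
        wide zero    len ws = narrow 0≤δ len
          (All.map (λ (Jx , u≤x , x≤) → Jx , u≤x , ≤-trans x≤ (≤-trans (≤-reflexive (+-identityʳ _)) (x≤x+y 0≤σ))) ws)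
        wide (suc k) {u} {xs} len ws = ≡.subst (λ ys → 0# ≤ L ys + e) (List.++-identityʳ xs)
          (widen (wide k) xs [] [] ws [] [] (≡.trans (≡.cong length (List.++-identityʳ xs)) len))

      -- If `L xs` were negative, some `δ` would satisfy `K * δ < - L xs`. Finitely many intervals
      -- of length `B * δ` cover the range from `- B` to `B`, so `wide` contradicts this.
      bounded-nonneg : ∀ {xs} → length xs ≡ suc n → All J xs → 0# ≤ L xs
      bounded-nonneg {xs} len Jxs Lxs<0 =
        contra (scale-below (x<0⇒0<-x Lxs<0) (bound-nonneg F (<⇒≤ 0<B) (suc n)))
        where
        contra : ∃[ δ ] 0# < δ × 0# < 1# - δ × 0# < - L xs - K * δ → ⊥
        contra (δ , 0<δ , _ , Kδ<ε) = ≤-refl (0<-resp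
          (solve 2 (λ a b → (a :+ b) :+ (:- a :- b) := :0) refl (L xs) (K * δ))
          (+-≤-< (wide (<⇒≤ 0<δ) k {u = - B} len (All.map window Jxs)) Kδ<ε))
          where
          exceeds = multiple-exceeds (*-pos 0<B 0<δ) (B + B)
          k = proj₁ exceeds
          window : ∀ {x} → J x → Window (- B) (k · (B * δ)) x
          window {x} Jx = Jx ,
            0≤y-x⇒x≤y (0≤-resp (solve 2 (λ x B → B :+ x := x :- :- B) refl x B) (proj₂ (J⇒∣∣≤B Jx))) ,
            0≤y-x⇒x≤y (0≤-resp (solve 3 (λ x B w → (B :- x) :+ (w :- (B :+ B)) := (:- B :+ w) :- x) refl x B (k · (B * δ)))
              (+-nonneg (proj₁ (J⇒∣∣≤B Jx)) (<⇒≤ (x<y⇒0<y-x (proj₂ exceeds)))))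

    module _ {p} {I : Carrier → Set p} (convex : Convex I)
      n (diagonal : ∀ {x} → I x → 0# ≤ L (List.replicate (suc n) x)) where

      -- The points of `I` bounded by a common bound of the entries again form a convex set, which
      -- reduces the claim to the bounded case.
      nonneg : ∀ {xs} → length xs ≡ suc n → All I xs → 0# ≤ L xs
      nonneg {xs} len Ixs = bounded-nonneg
        (λ 0≤α 0<β eq (Ix , x≤) (Iy , y≤) → convex 0≤α 0<β eq Ix Iy , ∣∣≤-convex 0≤α 0<β eq x≤ y≤)
        (proj₁ (proj₂ (All-∣∣-bound xs))) proj₂ n (λ (Ix , _) → diagonal Ix) len
        (All.zip (Ixs , proj₂ (proj₂ (All-∣∣-bound xs))))

      -- `zs` collects the entries already moved. Each use of `knot` moves one entry of `ys`; the
      -- summand in which `x` is replaced instead is nonnegative by `nonneg`.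
      pos-contract : ∀ {x μ} → I x → 0# < μ → 0# < 1# - μ → ∀ ys {zs} → length (x ∷ ys ++ zs) ≡ suc n →
        All I ys → All I zs → 0# < L (x ∷ map (contract x μ) ys ++ zs) → 0# < L (x ∷ ys ++ zs)
      pos-contract         Ix 0<μ 0<1-μ []            len Iys        Izs p = p
      pos-contract {x} {μ} Ix 0<μ 0<1-μ (y ∷ ys) {zs} len (Iy ∷ Iys) Izs p = 0<-resp
        (begin
          (1# - μ) * L (t ∷ y ∷ ys ++ zs) + μ * L (x ∷ t ∷ ys ++ zs)  ≈⟨ knot F (ys ++ zs) (contract-knot x μ y) ⟨
          ((1# - μ) + μ) * L (x ∷ y ∷ ys ++ zs)                       ≈⟨ solve 2 (λ μ a → ((:1 :- μ) :+ μ) :* a := a) refl μ _ ⟩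
          L (x ∷ y ∷ ys ++ zs)                                        ∎)
        (+-≤-< (*-nonneg (<⇒≤ 0<1-μ) (nonneg len (It ∷ Iy ∷ All.++⁺ Iys Izs)))
          (*-pos 0<μ (0<-resp (↭-invariant F (prep x (shift t ys zs)))
            (pos-contract Ix 0<μ 0<1-μ ys (≡.trans (↭-length (prep x (shift t ys zs))) len) Iys (It ∷ Izs)
              (0<-resp (↭-invariant F (prep x (↭-sym (shift t (map (contract x μ) ys) zs)))) p)))))
        where
        t = contract x μ y
        It = convex (<⇒≤ 0<1-μ) 0<μ (contract-knot x μ y) Ix Iy

      -- For `μ` so small that `K * μ` stays below the value at the constant tuple, the Lipschitz
      -- estimate makes `L` positive at the contracted tuple, and `pos-contract` leads back to the
      -- original one.
      pos : ∀ {x ys} → length (x ∷ ys) ≡ suc n → All I (x ∷ ys) → 0# < L (List.replicate (suc n) x) → 0# < L (x ∷ ys)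
      pos {x} {ys} len (Ix ∷ Iys) 0<Lxx = contracted (scale-below 0<Lxx (bound-nonneg F (+-nonneg 0≤B 0≤B) (suc n)))
        where
        B = proj₁ (All-∣∣-bound (x ∷ ys))
        0≤B = <⇒≤ (proj₁ (proj₂ (All-∣∣-bound (x ∷ ys))))
        x≤ = All.head (proj₂ (proj₂ (All-∣∣-bound (x ∷ ys))))
        ys≤ = All.tail (proj₂ (proj₂ (All-∣∣-bound (x ∷ ys))))
        K = bound F (B + B) (suc n)
        contracted : ∃[ μ ] 0# < μ × 0# < 1# - μ × 0# < L (List.replicate (suc n) x) - K * μ → 0# < L (x ∷ ys)
        contracted (μ , 0<μ , 0<1-μ , Kμ<Lxx) =
          ≡.subst (λ zs → 0# < L (x ∷ zs)) (List.++-identityʳ ys)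
            (pos-contract Ix 0<μ 0<1-μ ys (≡.trans (≡.cong (λ zs → length (x ∷ zs)) (List.++-identityʳ ys)) len) Iys []
              (≡.subst (λ zs → 0# < L (x ∷ zs)) (≡.sym (List.++-identityʳ ts)) 0<Lxts))
          where
          ts = map (contract x μ) ys
          close : ∣ L (x ∷ ts) - L (List.replicate (suc n) x) ∣≤ K * μ
          close = ≡.subst (λ k → ∣ L (x ∷ ts) - L (List.replicate k x) ∣≤ bound F (B + B) k * μ)
            (≡.trans (≡.cong suc (List.length-map _ ys)) len)
            (Near.close (lipschitz F (<⇒≤ 0<μ) (near-replicate
              (near-refl (<⇒≤ 0<μ) (∣∣≤-weaken B 0≤B x≤) ∷ All.map⁺ (All.map (near-contract 0<μ 0<1-μ x≤) ys≤)))))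
          0<Lxts : 0# < L (x ∷ ts)
          0<Lxts = 0<-resp
            (solve 3 (λ a b e → (b :- e) :+ (e :+ (a :- b)) := a) refl (L (x ∷ ts)) (L (List.replicate (suc n) x)) (K * μ))
            (+-<-≤ Kμ<Lxx (proj₂ close))

  -- Expansion into nondecreasing monomials

  Σˡ : ∀ {a} {A : Set a} → (A → Carrier) → List A → Carrier
  Σˡ f xs = foldr _+_ 0# (List.map f xs)

  module _ {a} {A : Set a} where

    Σˡ-cong : ∀ {f g : A → Carrier} → (∀ x → f x ≈ g x) → ∀ xs → Σˡ f xs ≈ Σˡ g xs
    Σˡ-cong f≈g []       = refl
    Σˡ-cong f≈g (x ∷ xs) = +-cong (f≈g x) (Σˡ-cong f≈g xs)

    Σˡ-*ˡ : ∀ d (f : A → Carrier) xs → Σˡ (λ x → d * f x) xs ≈ d * Σˡ f xs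
    Σˡ-*ˡ d f []       = sym (zeroʳ d)
    Σˡ-*ˡ d f (x ∷ xs) = trans (+-congˡ (Σˡ-*ˡ d f xs)) (sym (distribˡ d _ _))

    Σˡ-++ : ∀ (f : A → Carrier) xs ys → Σˡ f (xs ++ ys) ≈ Σˡ f xs + Σˡ f ys
    Σˡ-++ f []       ys = sym (+-identityˡ _)
    Σˡ-++ f (x ∷ xs) ys = trans (+-congˡ (Σˡ-++ f xs ys)) (sym (+-assoc _ _ _))

    -- Excluded terms become zeros, so that the sum runs over a full product of index ranges.
    Σˡ-filter : ∀ {p} {P : Pred A p} (P? : Decidable P) (f : A → Carrier) xs →
      Σˡ f (filter P? xs) ≈ Σˡ (λ x → if does (P? x) then f x else 0#) xs
    Σˡ-filter P? f []       = refl
    Σˡ-filter P? f (x ∷ xs) with does (P? x)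
    ... | true  = +-congˡ (Σˡ-filter P? f xs)
    ... | false = trans (Σˡ-filter P? f xs) (sym (+-identityˡ _))

    Σˡ-if : ∀ b (f : A → Carrier) xs → Σˡ (λ x → if b then f x else 0#) xs ≈ (if b then Σˡ f xs else 0#)
    Σˡ-if true  f xs       = refl
    Σˡ-if false f []       = refl
    Σˡ-if false f (x ∷ xs) = trans (+-identityˡ _) (Σˡ-if false f xs)

    Σˡ-map : ∀ {b} {B : Set b} (f : A → Carrier) (g : B → A) xs → Σˡ f (List.map g xs) ≡ Σˡ (f ∘ g) xs
    Σˡ-map f g []       = ≡.refl
    Σˡ-map f g (x ∷ xs) = ≡.cong (f (g x) +_) (Σˡ-map f g xs)

    Σˡ-tabulate : ∀ (f : A → Carrier) {n} (g : Fin n → A) → Σˡ f (List.tabulate g) ≡ sum (f ∘ g)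
    Σˡ-tabulate f {zero}  g = ≡.refl
    Σˡ-tabulate f {suc n} g = ≡.cong (f (g zero) +_) (Σˡ-tabulate f (g ∘ suc))

  Σˡ-cartesianProductWith : ∀ {a b d} {A : Set a} {B : Set b} {D : Set d} (f : D → Carrier) (g : A → B → D) xs ys →
    Σˡ f (cartesianProductWith g xs ys) ≈ Σˡ (λ x → Σˡ (λ y → f (g x y)) ys) xs
  Σˡ-cartesianProductWith f g []       ys = refl
  Σˡ-cartesianProductWith f g (x ∷ xs) ys = trans (Σˡ-++ f (List.map (g x) ys) _)
    (+-cong (reflexive (Σˡ-map f (g x) ys)) (Σˡ-cartesianProductWith f g xs ys))

  if-cong : ∀ b {x y} → x ≈ y → (if b then x else 0#) ≈ (if b then y else 0#)
  if-cong true  eq = eq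
  if-cong false eq = refl

  -- The variables that may follow `a i` in a nondecreasing monomial, `a i` included.
  from : ∀ {n} → Fin n → Vector Carrier n → List Carrier
  from zero    a = List.tabulate a
  from (suc i) a = from i (a ∘ suc)

  -- Sorts the monomials of degree `suc j` by their least index `k`.
  sum-from-zero : ∀ j {n} (a : Vector Carrier n) → sum (λ k → a k * hˡ j (from k a)) ≈ hˡ (suc j) (List.tabulate a)
  sum-from-zero j {zero}  a = refl
  sum-from-zero j {suc n} a = +-congˡ (sum-from-zero j (a ∘ suc))

  ≤?-suc : ∀ {n} (i k : Fin n) → does (suc i Fin.≤? suc k) ≡ does (i Fin.≤? k)
  ≤?-suc zero    k = ≡.refl
  ≤?-suc (suc i) k = ≡.refl

  sum-from : ∀ j {n} (i : Fin n) (a : Vector Carrier n) →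
    sum (λ k → if does (i Fin.≤? k) then a k * hˡ j (from k a) else 0#) ≈ hˡ (suc j) (from i a)
  sum-from j zero    a = sum-from-zero j a
  sum-from j (suc i) a = trans (+-identityˡ _) (trans
    (sum-cong-≋ (λ k → reflexive (≡.cong (λ b → if b then a (suc k) * hˡ j (from k (a ∘ suc)) else 0#) (≤?-suc i k))))
    (sum-from j i (a ∘ suc)))

  module _ {n} (a : Vector Carrier n) where

    weight : ∀ {j} → Vec (Fin n) j → Carrier
    weight is = if does (linked? Fin._≤?_ is) then monomial ℝ a is else 0#

    weight-∷ : ∀ {j} i k (is : Vec (Fin n) j) →
      weight (i ∷ k ∷ is) ≈ a i * (if does (i Fin.≤? k) then weight (k ∷ is) else 0#)
    weight-∷ i k is with does (i Fin.≤? k) | does (linked? Fin._≤?_ (k ∷ is))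
    ... | true  | true  = refl
    ... | true  | false = sym (zeroʳ (a i))
    ... | false | _     = sym (zeroʳ (a i))

    Σˡ-allFin : ∀ (f : Fin n → Carrier) → Σˡ f (allFin n) ≈ sum f
    Σˡ-allFin f = reflexive (Σˡ-tabulate f (λ i → i))

    -- Induction on `j`: the index `k` after `i` contributes only if `i ≤ k`, and `sum-from` adds up
    -- these contributions.
    Σˡ-tuples-∷ : ∀ j i → Σˡ (λ v → weight (i ∷ v)) (tuples n j) ≈ a i * hˡ j (from i a)
    Σˡ-tuples-∷ zero    i = +-identityʳ _
    Σˡ-tuples-∷ (suc j) i = begin
      Σˡ (λ v → weight (i ∷ v)) (cartesianProductWith _∷_ (allFin n) (tuples n j))
        ≈⟨ Σˡ-cartesianProductWith (λ v → weight (i ∷ v)) _∷_ (allFin n) (tuples n j) ⟩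
      Σˡ (λ k → Σˡ (λ v → weight (i ∷ k ∷ v)) (tuples n j)) (allFin n)
        ≈⟨ Σˡ-cong (λ k → trans (Σˡ-cong (weight-∷ i k) (tuples n j)) (Σˡ-*ˡ (a i) _ (tuples n j))) (allFin n) ⟩
      Σˡ (λ k → a i * Σˡ (λ v → if does (i Fin.≤? k) then weight (k ∷ v) else 0#) (tuples n j)) (allFin n)
        ≈⟨ Σˡ-*ˡ (a i) _ (allFin n) ⟩
      a i * Σˡ (λ k → Σˡ (λ v → if does (i Fin.≤? k) then weight (k ∷ v) else 0#) (tuples n j)) (allFin n)
        ≈⟨ *-congˡ (Σˡ-cong (λ k → trans (Σˡ-if (does (i Fin.≤? k)) _ (tuples n j))
             (if-cong (does (i Fin.≤? k)) (Σˡ-tuples-∷ j k))) (allFin n)) ⟩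
      a i * Σˡ (λ k → if does (i Fin.≤? k) then a k * hˡ j (from k a) else 0#) (allFin n)
        ≈⟨ *-congˡ (trans (Σˡ-allFin _) (sum-from j i a)) ⟩
      a i * hˡ (suc j) (from i a) ∎

    h≈hˡ : ∀ j → h ℝ j a ≈ hˡ j (List.tabulate a)
    h≈hˡ zero    = +-identityʳ 1#
    h≈hˡ (suc j) = begin
      Σˡ (monomial ℝ a) (nondecreasing n (suc j))
        ≈⟨ Σˡ-filter (linked? Fin._≤?_) (monomial ℝ a) (tuples n (suc j)) ⟩
      Σˡ weight (cartesianProductWith _∷_ (allFin n) (tuples n j))
        ≈⟨ Σˡ-cartesianProductWith weight _∷_ (allFin n) (tuples n j) ⟩
      Σˡ (λ i → Σˡ (λ v → weight (i ∷ v)) (tuples n j)) (allFin n)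
        ≈⟨ Σˡ-cong (Σˡ-tuples-∷ j) (allFin n) ⟩
      Σˡ (λ i → a i * hˡ j (from i a)) (allFin n)
        ≈⟨ Σˡ-allFin _ ⟩
      sum (λ i → a i * hˡ j (from i a))
        ≈⟨ sum-from-zero j a ⟩
      hˡ (suc j) (List.tabulate a) ∎

  -- Quadratic forms in the complete homogeneous polynomials

  combination-pos : ∀ {α β x y t} r → 0# ≤ α → 0# < β → (α + β) * t ≈ α * x + β * y →
    0# < x - r → 0# < y - r → 0# < t - r
  combination-pos {α} {β} {x} {y} {t} r 0≤α 0<β eq 0<x-r 0<y-r = *-cancel-pos (+-≤-< 0≤α 0<β) (0<-resp
    (begin
      α * (x - r) + β * (y - r)             ≈⟨ solve 5 (λ α β x y r → α :* (x :- r) :+ β :* (y :- r) := (α :* x :+ β :* y) :- (α :+ β) :* r) refl α β x y r ⟩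
      (α * x + β * y) - (α + β) * r         ≈⟨ +-congʳ eq ⟨
      (α + β) * t - (α + β) * r             ≈⟨ solve 3 (λ s t r → s :* t :- s :* r := s :* (t :- r)) refl (α + β) t r ⟩
      (α + β) * (t - r)                     ∎)
    (+-≤-< (*-nonneg 0≤α (<⇒≤ 0<x-r)) (*-pos 0<β 0<y-r)))

  <±-convex : ∀ r → Convex (λ x → r <± [ x ])
  <±-convex ⊥±    _ _ _ _ _ = Extrema.⊥±<[ _ ]
  <±-convex ⊤±    _ _ _ () _
  <±-convex [ r ] 0≤α 0<β eq Extrema.[ r<x ] Extrema.[ r<y ] =
    Extrema.[ 0<y-x⇒x<y (combination-pos r 0≤α 0<β eq (x<y⇒0<y-x r<x) (x<y⇒0<y-x r<y)) ]

  >±-convex : ∀ s → Convex (λ x → [ x ] <± s)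
  >±-convex ⊥±    _ _ _ Supremum.[ () ] _
  >±-convex ⊤±    _ _ _ _ _ = Extrema.[ _ ]<⊤±
  -- Negation turns the upper bound `s` into the lower bound `- s`.
  >±-convex [ s ] {α} {β} {x} {y} {t} 0≤α 0<β eq Extrema.[ x<s ] Extrema.[ y<s ] = Extrema.[ 0<y-x⇒x<y
    (0<-resp (flip t) (combination-pos (- s) 0≤α 0<β
      (trans (solve 3 (λ α β t → (α :+ β) :* :- t := :- ((α :+ β) :* t)) refl α β t) (trans (-‿cong eq)
        (solve 4 (λ α β x y → :- (α :* x :+ β :* y) := α :* :- x :+ β :* :- y) refl α β x y)))
      (0<-resp (sym (flip x)) (x<y⇒0<y-x x<s)) (0<-resp (sym (flip y)) (x<y⇒0<y-x y<s)))) ]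
    where
    flip : ∀ x → - x - - s ≈ s - x
    flip x = solve 2 (λ x s → :- x :- :- s := s :- x) refl x s

  ∈⦅⦆-convex : ∀ r s → Convex (_∈⦅ r , s ⦆)
  ∈⦅⦆-convex r s 0≤α 0<β eq (r<x , x<s) (r<y , y<s) = <±-convex r 0≤α 0<β eq r<x r<y , >±-convex s 0≤α 0<β eq x<s y<s

  module _ {m} (coeff : Fin m → Fin m → Carrier) where

    bilinear : (u v : Fin m → Carrier) → Carrier
    bilinear u v = sum λ j → sum λ k → (coeff j k * u j) * v k

    bilinear-cong : ∀ {u u′ v v′} → (∀ j → u j ≈ u′ j) → (∀ k → v k ≈ v′ k) → bilinear u v ≈ bilinear u′ v′
    bilinear-cong u≈ v≈ = sum-cong-≋ {m} λ j → sum-cong-≋ {m} λ k → *-cong (*-congˡ {coeff j k} (u≈ j)) (v≈ k)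

    bilinear-zeroʳ : ∀ u {v} → (∀ k → v k ≈ 0#) → bilinear u v ≈ 0#
    bilinear-zeroʳ u {v} v≈0 = trans
      (sum-cong-≋ {m} λ j → trans (sum-cong-≋ {m} λ k → trans (*-congˡ {coeff j k * u j} (v≈0 k)) (zeroʳ _)) (sum-replicate-zero m))
      (sum-replicate-zero m)

    hˡ₊ : List Carrier → Fin m → Carrier
    hˡ₊ xs j = hˡ (suc (toℕ j)) xs

    Q : (xs ys : List Carrier) → Carrier
    Q xs ys = bilinear (hˡ₊ xs) (hˡ₊ ys)

    Q-functionalˡ : ∀ ys → KnotFunctional (λ xs → Q xs ys)
    Q-functionalˡ ys = sum-functional _ λ j → sum-functional _ λ k →
      *-functionalʳ (hˡ (suc (toℕ k)) ys) (*-functionalˡ (coeff j k) (hˡ-functional (suc (toℕ j))))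

    Q-functionalʳ : ∀ xs → KnotFunctional (Q xs)
    Q-functionalʳ xs = sum-functional _ λ j → sum-functional _ λ k →
      *-functionalˡ (coeff j k * hˡ (suc (toℕ j)) xs) (hˡ-functional (suc (toℕ k)))

    tabulate-replicate : ∀ n (x : Carrier) → List.tabulate (replicate n x) ≡ List.replicate n x
    tabulate-replicate zero    x = ≡.refl
    tabulate-replicate (suc n) x = ≡.cong (x ∷_) (tabulate-replicate n x)

    h-replicate : ∀ n j x → h ℝ j (replicate n x) ≈ hˡ j (List.replicate n x)
    h-replicate n j x = trans (h≈hˡ (replicate n x) j) (reflexive (≡.cong (hˡ j) (tabulate-replicate n x)))

    P≈Q : ∀ n x y → P ℝ n coeff x y ≈ Q (List.replicate n x) (List.replicate n y)
    P≈Q n x y = bilinear-cong (λ j → h-replicate n (suc (toℕ j)) x) (λ k → h-replicate n (suc (toℕ k)) y)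

    H≈Q : ∀ {n} (a : Vector Carrier n) → H ℝ coeff a ≈ Q (List.tabulate a) (List.tabulate a)
    H≈Q a = bilinear-cong (λ j → h≈hˡ a (suc (toℕ j))) (λ k → h≈hˡ a (suc (toℕ k)))

    hˡ-zero : ∀ k {ys} → All (_≈ 0#) ys → hˡ (suc k) ys ≈ 0#
    hˡ-zero k []                = refl
    hˡ-zero k {y ∷ ys} (y≈0 ∷ ys≈0) = trans (+-cong (trans (*-congʳ y≈0) (zeroˡ _)) (hˡ-zero k ys≈0)) (+-identityʳ 0#)

    module _ n (r s : Carrier ±)
      (P≥0 : ∀ x y → x ∈⦅ r , s ⦆ → y ∈⦅ r , s ⦆ → (x # 0#) ⊎ (y # 0#) → P ℝ (suc n) coeff x y ≥ 0#)
      (H>0 : ∀ x → x ∈⦅ r , s ⦆ → x # 0# → 0# < H ℝ coeff (replicate (suc n) x)) where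

      -- The hypothesis on `P` leaves out the origin. Were the value negative, `y` could not be
      -- apart from zero, so `y ≈ 0#` by tightness; as all degrees are at least one, the value would
      -- then be zero.
      Q-replicate-≥0 : ∀ {x y} → x ∈⦅ r , s ⦆ → y ∈⦅ r , s ⦆ →
        0# ≤ Q (List.replicate (suc n) x) (List.replicate (suc n) y)
      Q-replicate-≥0 {x} {y} x∈ y∈ Qxy<0 = <-irrefl
        (bilinear-zeroʳ (hˡ₊ (List.replicate (suc n) x)) λ k → hˡ-zero (toℕ k) (All.replicate⁺ (suc n)
          (proj₁ (tight y 0#) λ y#0 → P≥0 x y x∈ y∈ (inj₂ y#0) (<-respˡ-≈ (sym (P≈Q (suc n) x y)) Qxy<0))))
        Qxy<0

      -- Starting from both arguments constant, `pos` first frees the left argument, then the right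
      -- one. The second use needs nonnegativity at all constant right arguments, which is `nonneg`
      -- in the left argument.
      Q-pos : ∀ {x ys} → length (x ∷ ys) ≡ suc n → All (_∈⦅ r , s ⦆) (x ∷ ys) → x # 0# → 0# < Q (x ∷ ys) (x ∷ ys)
      Q-pos {x} {ys} len ∈s@(x∈ ∷ _) x#0 =
        pos (Q-functionalʳ (x ∷ ys)) (∈⦅⦆-convex r s) n Q[xs,yⁿ]≥0 len ∈s
          (pos (Q-functionalˡ (List.replicate (suc n) x)) (∈⦅⦆-convex r s) n (λ y∈ → Q-replicate-≥0 y∈ x∈) len ∈s
            (0<-resp (trans (H≈Q (replicate (suc n) x))
              (reflexive (≡.cong (λ xs → Q xs xs) (tabulate-replicate (suc n) x)))) (H>0 x x∈ x#0)))
        where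
        Q[xs,yⁿ]≥0 : ∀ {y} → y ∈⦅ r , s ⦆ → 0# ≤ Q (x ∷ ys) (List.replicate (suc n) y)
        Q[xs,yⁿ]≥0 {y} y∈ = nonneg (Q-functionalˡ (List.replicate (suc n) y)) (∈⦅⦆-convex r s) n
          (λ x∈ → Q-replicate-≥0 x∈ y∈) len ∈s

  -- Moving a nonzero entry to the front; the theorem.

  select : ∀ {n} (a : Vector Carrier n) i → ∃[ ys ] List.tabulate a ↭ a i ∷ ys
  select a i with ∈-∃++ (∈-tabulate⁺ {f = a} i)
  ... | us , vs , eq = us ++ vs , ↭-trans (↭-reflexive eq) (shift (a i) us vs)

theorem4 : ∀ {c ℓ₁ ℓ₂ ℓ₃} (ℝ : RealField c ℓ₁ ℓ₂ ℓ₃) →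
    let open RealField ℝ in
    (n m : ℕ) → 1 ℕ.≤ n → 1 ℕ.≤ m →
    (coeff : Fin m → Fin m → Carrier) →
    (r s : Carrier ±) → r <± s →
    (∀ x y → x ∈⦅ r , s ⦆ → y ∈⦅ r , s ⦆ → (x # 0#) ⊎ (y # 0#) → P ℝ n coeff x y ≥ 0#) →
    (∀ x → x ∈⦅ r , s ⦆ → x # 0# → 0# < H ℝ coeff (replicate n x)) →
    (a : Vector Carrier n) → (∀ i → a i ∈⦅ r , s ⦆) → (∃[ i ] (a i # 0#)) → 0# < H ℝ coeff a
theorem4 ℝ (suc n) m _ _ coeff r s _ P≥0 H>0 a a∈ (i , ai#0) =
  -- `Q` is symmetric in the entries of each argument separately, so the two copies of the tuple are
  -- permuted one after the other.
  0<-resp (sym (trans (H≈Q coeff a) (trans (↭-invariant (Q-functionalˡ coeff (List.tabulate a)) ↭ys)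
      (↭-invariant (Q-functionalʳ coeff (a i ∷ ys)) ↭ys))))
    (Q-pos coeff n r s P≥0 H>0 (≡.trans (≡.sym (↭-length ↭ys)) (List.length-tabulate a))
      (All-resp-↭ ↭ys (All.tabulate⁺ a∈)) ai#0)
  where
  open OrderedField ℝ
  open HomogeneousPositivity ℝ
  ys = proj₁ (select a i)
  ↭ys = proj₂ (select a i)
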